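{- Stone Game III restricted to arbitrary positive integer values and promised to have a winner still requires $\Omega(n)$ worst-case time. That is, for every deterministic algorithm in the random-access input model that, for every $n$ and every input $(v_0,\ldots,v_{n-1})$ of positive integers (with no upper bound on the values) whose Stone Game III outcome is not a tie, outputs the correct winner in $\{\texttt{Alice},\texttt{Bob}\}$, the worst-case running time over such inputs of length $n$ is $\Omega(n)$.
   Context: Stone Game III: a row of $n$ stones has integer values $v_0,v_1,\ldots,v_{n-1}$. Alice and Bob alternate turns, Alice moving first. On each turn a player removes the first one, two, or three remaining stones (no more than remain) and adds their values to his or her own score. Play ends when no stones remain. Both players know all values and play optimally (each maximizes own final score, equivalently own score minus the opponent's score). The outcome is $\texttt{Alice}$, $\texttt{Bob}$ or $\texttt{Tie}$ according to the final scores under optimal play (the player with the higher score wins; equal scores are a tie). Positive, unbounded, winner-promised variant: every input value is an integer at least $1$, there is no fixed upper bound on the values, and the input is guaranteed to have a winner (the outcome under optimal play is not $\texttt{Tie}$). The algorithm is required to be correct only on such inputs. Random-access input model (deterministic query / decision-tree model): the length $n$ is known, and a deterministic algorithm may inspect any chosen position $i$, learning $v_i$, at unit cost. The choice of the next position may depend on all values inspected so far. Other unit-cost arithmetic and control operations are allowed. The algorithm's execution and output on an input depend on that input only through $n$ and the values inspected. Each inspection costs at least one unit of time, so the running time is at least the number of inspections. -}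

module Defs where

open import Data.Fin.Base using (Fin)
open import Data.Integer.Base using (ℤ; 0ℤ; 1ℤ) renaming (_+_ to _+ℤ_; _≤_ to _≤ℤ_)
import Data.Integer.Properties as ℤ
open import Data.List.Base using ([]; _∷_)
open import Data.List.Extrema ℤ.≤-totalOrder using (argmax)
open import Data.Nat.Base using (ℕ; zero; suc; _*_; _≤_)
open import Data.Product.Base using (Σ-syntax; ∃-syntax; _×_; _,_)
open import Data.Vec.Base using (Vec; []; _∷_; lookup)
open import Data.Vec.Relation.Unary.All using (All)
open import Level using (0ℓ)
open import Relation.Binary.Definitions using (tri<; tri≈; tri>)
open import Relation.Binary.PropositionalEquality using (_≡_; _≢_)
open import Relation.Unary using (Pred)

data Player : Set where
  Alice Bob : Player

opponent : Player → Player
opponent Alice = Bob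
opponent Bob   = Alice

record Scores : Set where
  constructor ⟨_,_⟩
  field
    alice bob : ℤ

open Scores public

score : Player → Scores → ℤ
score Alice = alice
score Bob   = bob

credit : Player → ℤ → Scores → Scores
credit Alice x ⟨ a , b ⟩ = ⟨ a +ℤ x , b ⟩
credit Bob   x ⟨ a , b ⟩ = ⟨ a , b +ℤ x ⟩

-- Final scores under optimal play (backward induction) when p is to move, vs is
-- the remaining row and s the current scores.  Every play from a given position
-- ends with the same total score, so how argmax breaks ties for the mover does
-- not affect the result.
finalScores : ∀ {n} → Player → Vec ℤ n → Scores → Scores
finalScores p []           s = s
finalScores p (x ∷ [])     s = finalScores (opponent p) [] (credit p x s)
finalScores p (x ∷ y ∷ []) s = argmax (score p)
  (finalScores (opponent p) (y ∷ []) (credit p x s))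
  (finalScores (opponent p) []       (credit p (x +ℤ y) s) ∷ [])
finalScores p (x ∷ y ∷ z ∷ vs) s = argmax (score p)
  (finalScores (opponent p) (y ∷ z ∷ vs) (credit p x s))
  (finalScores (opponent p) (z ∷ vs)     (credit p (x +ℤ y) s) ∷
   finalScores (opponent p) vs           (credit p (x +ℤ y +ℤ z) s) ∷ [])

data Outcome : Set where
  winner : Player → Outcome
  tie    : Outcome

compareScores : Scores → Outcome
compareScores ⟨ a , b ⟩ with ℤ.<-cmp a b
... | tri< _ _ _ = winner Bob
... | tri≈ _ _ _ = tie
... | tri> _ _ _ = winner Alice

outcome : ∀ {n} → Vec ℤ n → Outcome
outcome v = compareScores (finalScores Alice v ⟨ 0ℤ , 0ℤ ⟩)

Admissible : ∀ {n} → Vec ℤ n → Set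
Admissible v = All (1ℤ ≤ℤ_) v × outcome v ≢ tie

data Action (n : ℕ) (S : Set) : Set where
  output  : Player → Action n S
  compute : S → Action n S
  inspect : Fin n → (ℤ → S) → Action n S

-- A deterministic transition system for each length n.  States are arbitrary, so
-- a state may record everything inspected so far; the input is reachable only
-- through inspect.  Termination is not built in: off the admissible inputs an
-- algorithm may run forever.
record Algorithm : Set₁ where
  field
    State : ℕ → Set
    start : ∀ n → State n
    step  : ∀ {n} → State n → Action n (State n)

module _ (A : Algorithm) where
  open Algorithm A

  -- From the given state, on input v, the algorithm outputs w after t inspections
  -- and other operations in total.
  data HaltsFrom {n} (v : Vec ℤ n) : State n → Player → ℕ → Set where
    halt : ∀ {σ w} → step σ ≡ output w → HaltsFrom v σ w zero
    work : ∀ {σ σ′ w t} → step σ ≡ compute σ′ →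
           HaltsFrom v σ′ w t → HaltsFrom v σ w (suc t)
    look : ∀ {σ i k w t} → step σ ≡ inspect i k →
           HaltsFrom v (k (lookup v i)) w t → HaltsFrom v σ w (suc t)

  Halts : ∀ {n} → Vec ℤ n → Player → ℕ → Set
  Halts {n} v = HaltsFrom v (start n)

  Correct : Set
  Correct = ∀ n (v : Vec ℤ n) → Admissible v →
            ∃[ w ] ∃[ t ] Halts v w t × outcome v ≡ winner w

  RunningTime : ∀ n → Pred ℕ 0ℓ
  RunningTime n t = Σ[ v ∈ Vec ℤ n ] Admissible v × ∃[ w ] Halts v w t

-- The supremum of T n, possibly infinite, is Ω(g n): for some c and n₀, the
-- supremum is at least g n / c for all n ≥ n₀.  For a set of naturals this means
-- that some element is at least g n / c.
WorstCaseΩ : (ℕ → ℕ) → (ℕ → Pred ℕ 0ℓ) → Set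
WorstCaseΩ g T = ∃[ c ] ∃[ n₀ ] ∀ n → n₀ ≤ n → ∃[ t ] T n t × g n ≤ c * t

{-# OPTIONS --safe #-}
-- A stone worth more than half of the total decides the game: whoever takes it wins,
-- and when its index is 3 mod 4 the second player can make sure to take it.  Start
-- from a row dominated by stone 0, which Alice wins.  Making any uninspected stone
-- with index 3 mod 4 dominate instead hands the win to Bob, so a correct algorithm
-- must inspect all of these stones on that one row.
module Submission where

open import Defs
open import Data.Fin.Base using (Fin; zero; suc; combine; inject≤)
open import Data.Fin.Patterns using (3F)
open import Data.Fin.Properties using (_≟_; combine-injectiveˡ; inject≤-injective; injective⇒≤)
open import Data.Integer.Base using (ℤ; 0ℤ; 1ℤ; +≤+) renaming (_+_ to _+ℤ_; _≤_ to _≤ℤ_; _<_ to _<ℤ_)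
import Data.Integer.Properties as ℤ
open import Data.Integer.Tactic.RingSolver using (solve-∀)
open import Data.List.Base using (List; []; _∷_; length)
open import Data.List.Extrema ℤ.≤-totalOrder using (argmax-all; f[⊥]≤f[argmax]; f[xs]≤f[argmax])
open import Data.List.Membership.DecPropositional using (_∈?_)
open import Data.List.Membership.Propositional using (_∈_)
import Data.List.Membership.Setoid.Properties as Membership
import Data.List.Relation.Unary.All as List
open import Data.List.Relation.Unary.Any using (index; here; there)
open import Data.Nat.Base using (ℕ; zero; suc; _+_; _*_; _/_; _%_; _≤_; z≤n; s≤s)
open import Data.Nat.DivMod using (m≡m%n+[m/n]*n; m/n*n≤m; m%n<n; m≥n⇒m/n>0)
import Data.Nat.Properties as ℕ
open import Data.Product.Base using (∃-syntax; _×_; _,_; proj₁)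
open import Data.Vec.Base using (Vec; []; _∷_; lookup; replicate; foldr′; _[_]≔_)
open import Data.Vec.Properties using (lookup∘update; lookup∘update′)
open import Data.Vec.Relation.Unary.All using (All; []; _∷_)
import Data.Vec.Relation.Unary.All.Properties as All
open import Function.Base using (id)
open import Relation.Binary.Definitions using (tri<; tri≈; tri>)
open import Relation.Binary.PropositionalEquality
open import Relation.Nullary.Decidable.Core using (decidable-stable)
open import Relation.Nullary.Negation.Core using (contradiction)

-- Elementary facts on sums and scores.

sum : ∀ {n} → Vec ℤ n → ℤ
sum = foldr′ _+ℤ_ 0ℤ

total : Scores → ℤ
total ⟨ a , b ⟩ = a +ℤ b

Positive : ∀ {n} → Vec ℤ n → Set
Positive = All (1ℤ ≤ℤ_)

≤-+-nonNeg : ∀ {x} a → 0ℤ ≤ℤ x → a ≤ℤ a +ℤ x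
≤-+-nonNeg {x} a 0≤x = subst (λ b → b ≤ℤ a +ℤ x) (ℤ.+-identityʳ a) (ℤ.+-monoʳ-≤ a 0≤x)

≤-nonNeg-+ : ∀ {x} a → 0ℤ ≤ℤ x → a ≤ℤ x +ℤ a
≤-nonNeg-+ {x} a 0≤x = subst (λ b → b ≤ℤ x +ℤ a) (ℤ.+-identityˡ a) (ℤ.+-monoˡ-≤ a 0≤x)

1≤⇒0≤ : ∀ {x} → 1ℤ ≤ℤ x → 0ℤ ≤ℤ x
1≤⇒0≤ = ℤ.≤-trans (+≤+ z≤n)

score-credit : ∀ p x s → score p (credit p x s) ≡ score p s +ℤ x
score-credit Alice x s = refl
score-credit Bob   x s = refl

score≤credit : ∀ q p {x} s → 0ℤ ≤ℤ x → score q s ≤ℤ score q (credit p x s)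
score≤credit Alice Alice s 0≤x = ≤-+-nonNeg _ 0≤x
score≤credit Alice Bob   s 0≤x = ℤ.≤-refl
score≤credit Bob   Alice s 0≤x = ℤ.≤-refl
score≤credit Bob   Bob   s 0≤x = ≤-+-nonNeg _ 0≤x

total-credit : ∀ p x s → total (credit p x s) ≡ total s +ℤ x
total-credit Alice x ⟨ a , b ⟩ = eq a b x
  where
  eq : ∀ a b x → a +ℤ x +ℤ b ≡ a +ℤ b +ℤ x
  eq = solve-∀
total-credit Bob   x ⟨ a , b ⟩ = sym (ℤ.+-assoc a b x)

-- Invariants of optimal play and lower bounds for the mover.

after : ∀ {n} → Player → ℤ → Vec ℤ n → Scores → Scores
after p x v s = finalScores (opponent p) v (credit p x s)

module _ (P : Scores → Set) (p : Player) {x y : ℤ} where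

  -- `argmax` returns one of its candidates, so a property shared by all branches survives whichever
  -- move is chosen.
  finalScores-elim₂ : ∀ s → P (after p x (y ∷ []) s) → P (after p (x +ℤ y) [] s) →
                      P (finalScores p (x ∷ y ∷ []) s)
  finalScores-elim₂ s p₁ p₂ = argmax-all (score p) {P = P}
    {after p x (y ∷ []) s} {after p (x +ℤ y) [] s ∷ []}
    p₁ (p₂ List.∷ List.[])

  finalScores-elim₃ : ∀ {n z} (v : Vec ℤ n) s → P (after p x (y ∷ z ∷ v) s) →
                      P (after p (x +ℤ y) (z ∷ v) s) → P (after p (x +ℤ y +ℤ z) v s) →
                      P (finalScores p (x ∷ y ∷ z ∷ v) s)
  finalScores-elim₃ {z = z} v s p₁ p₂ p₃ = argmax-all (score p) {P = P}
    {after p x (y ∷ z ∷ v) s} {after p (x +ℤ y) (z ∷ v) s ∷ after p (x +ℤ y +ℤ z) v s ∷ []}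
    p₁ (p₂ List.∷ p₃ List.∷ List.[])

-- A move only transfers value from the row to a score. This conservation law later turns a bound on
-- one score into a comparison of both.
total-finalScores : ∀ {n} p (v : Vec ℤ n) s → total (finalScores p v s) ≡ total s +ℤ sum v
total-after : ∀ {n} p x (v : Vec ℤ n) s → total (after p x v s) ≡ total s +ℤ (x +ℤ sum v)

total-finalScores p [] s = sym (ℤ.+-identityʳ (total s))
total-finalScores p (x ∷ []) s = total-after p x [] s
total-finalScores p (x ∷ y ∷ []) s =
  finalScores-elim₂ (λ s′ → total s′ ≡ total s +ℤ (x +ℤ (y +ℤ 0ℤ))) p s
    (total-after p x (y ∷ []) s)
    (trans (total-after p (x +ℤ y) [] s) (cong (total s +ℤ_) (ℤ.+-assoc x y 0ℤ)))
total-finalScores p (x ∷ y ∷ z ∷ v) s =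
  finalScores-elim₃ (λ s′ → total s′ ≡ total s +ℤ (x +ℤ (y +ℤ (z +ℤ sum v)))) p v s
    (total-after p x (y ∷ z ∷ v) s)
    (trans (total-after p (x +ℤ y) (z ∷ v) s) (cong (total s +ℤ_) (ℤ.+-assoc x y (z +ℤ sum v))))
    (trans (total-after p (x +ℤ y +ℤ z) v s) (cong (total s +ℤ_) (eq x y z (sum v))))
  where
  eq : ∀ x y z r → x +ℤ y +ℤ z +ℤ r ≡ x +ℤ (y +ℤ (z +ℤ r))
  eq = solve-∀

total-after p x v s = begin
  total (after p x v s)             ≡⟨ total-finalScores (opponent p) v (credit p x s) ⟩
  total (credit p x s) +ℤ sum v     ≡⟨ cong (_+ℤ sum v) (total-credit p x s) ⟩
  total s +ℤ x +ℤ sum v             ≡⟨ ℤ.+-assoc (total s) x (sum v) ⟩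
  total s +ℤ (x +ℤ sum v)           ∎
  where open ≡-Reasoning

-- Every stone is worth at least 1, so no score drops as play goes on: what a player has secured
-- stays secured.
score≤finalScores : ∀ {n} q p (v : Vec ℤ n) s → Positive v → score q s ≤ℤ score q (finalScores p v s)
score≤after : ∀ {n} q p {x} (v : Vec ℤ n) s → 0ℤ ≤ℤ x → Positive v →
              score q s ≤ℤ score q (after p x v s)

score≤finalScores q p [] s [] = ℤ.≤-refl
score≤finalScores q p (x ∷ []) s (px ∷ []) = score≤after q p [] s (1≤⇒0≤ px) []
score≤finalScores q p (x ∷ y ∷ []) s (px ∷ py ∷ []) =
  finalScores-elim₂ (λ s′ → score q s ≤ℤ score q s′) p s
    (score≤after q p (y ∷ []) s (1≤⇒0≤ px) (py ∷ []))
    (score≤after q p [] s (ℤ.+-mono-≤ (1≤⇒0≤ px) (1≤⇒0≤ py)) [])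
score≤finalScores q p (x ∷ y ∷ z ∷ v) s (px ∷ py ∷ pz ∷ pv) =
  finalScores-elim₃ (λ s′ → score q s ≤ℤ score q s′) p v s
    (score≤after q p (y ∷ z ∷ v) s 0≤x (py ∷ pz ∷ pv))
    (score≤after q p (z ∷ v) s 0≤x+y (pz ∷ pv))
    (score≤after q p v s (ℤ.+-mono-≤ 0≤x+y (1≤⇒0≤ pz)) pv)
  where
  0≤x   = 1≤⇒0≤ px
  0≤x+y = ℤ.+-mono-≤ 0≤x (1≤⇒0≤ py)

score≤after q p {x} v s 0≤x pv =
  ℤ.≤-trans (score≤credit q p s 0≤x) (score≤finalScores q (opponent p) v (credit p x s) pv)

score+taken≤ : ∀ {n} p {x} (v : Vec ℤ n) s → Positive v → score p s +ℤ x ≤ℤ score p (after p x v s)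
score+taken≤ p {x} v s pv =
  subst (_≤ℤ score p (after p x v s)) (score-credit p x s)
    (score≤finalScores p (opponent p) v (credit p x s) pv)

-- The mover maximizes, so each legal move is a lower bound. The cases follow the clauses of
-- `finalScores`, which offer fewer moves near the end of the row; a single stone leaves no choice.
take₁-≤ : ∀ {n} p x (v : Vec ℤ n) s →
          score p (after p x v s) ≤ℤ score p (finalScores p (x ∷ v) s)
take₁-≤ p x []          s = ℤ.≤-refl
take₁-≤ p x (y ∷ [])    s = f[⊥]≤f[argmax] {f = score p}
  (after p x (y ∷ []) s) (after p (x +ℤ y) [] s ∷ [])
take₁-≤ p x (y ∷ z ∷ v) s = f[⊥]≤f[argmax] {f = score p}
  (after p x (y ∷ z ∷ v) s) (after p (x +ℤ y) (z ∷ v) s ∷ after p (x +ℤ y +ℤ z) v s ∷ [])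

take₂-≤ : ∀ {n} p x y (v : Vec ℤ n) s →
          score p (after p (x +ℤ y) v s) ≤ℤ score p (finalScores p (x ∷ y ∷ v) s)
take₂-≤ p x y []      s = List.head (f[xs]≤f[argmax] {f = score p}
  (after p x (y ∷ []) s) (after p (x +ℤ y) [] s ∷ []))
take₂-≤ p x y (z ∷ v) s = List.head (f[xs]≤f[argmax] {f = score p}
  (after p x (y ∷ z ∷ v) s) (after p (x +ℤ y) (z ∷ v) s ∷ after p (x +ℤ y +ℤ z) v s ∷ []))

take₃-≤ : ∀ {n} p x y z (v : Vec ℤ n) s →
          score p (after p (x +ℤ y +ℤ z) v s) ≤ℤ score p (finalScores p (x ∷ y ∷ z ∷ v) s)
take₃-≤ p x y z v s = List.head (List.tail (f[xs]≤f[argmax] {f = score p}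
  (after p x (y ∷ z ∷ v) s) (after p (x +ℤ y) (z ∷ v) s ∷ after p (x +ℤ y +ℤ z) v s ∷ [])))

-- Strategies for taking a chosen stone.

-- Takes p i q: with p to move, q has a strategy to take stone i.
data Takes (p : Player) : ∀ {n} → Fin n → Player → Set where
  now₁   : ∀ {n} → Takes p {suc n} zero p
  now₂   : ∀ {n} → Takes p {suc (suc n)} (suc zero) p
  now₃   : ∀ {n} → Takes p {suc (suc (suc n))} (suc (suc zero)) p
  later₁ : ∀ {n} {i : Fin n} → Takes (opponent p) i p → Takes p (suc i) p
  later₂ : ∀ {n} {i : Fin n} → Takes (opponent p) i p → Takes p (suc (suc i)) p
  later₃ : ∀ {n} {i : Fin n} → Takes (opponent p) i p → Takes p (suc (suc (suc i))) p
  forced : ∀ {n} {i : Fin n} {q} → Takes (opponent p) (suc (suc i)) q →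
           Takes (opponent p) (suc i) q → Takes (opponent p) i q → Takes p (suc (suc (suc i))) q

-- Induction on the strategy. Where it prescribes a move, optimal play does at least as well for the
-- mover; a `forced` node covers all three moves, so the branch selected by `argmax` satisfies the
-- bound too.
score+stone≤ : ∀ {n} {p q} {i : Fin n} → Takes p i q → (v : Vec ℤ n) → Positive v → ∀ s →
               score q s +ℤ lookup v i ≤ℤ score q (finalScores p v s)
score+stone≤after : ∀ {n} {p q x} {i : Fin n} → Takes (opponent p) i q → (v : Vec ℤ n) →
                    0ℤ ≤ℤ x → Positive v → ∀ s →
                    score q s +ℤ lookup v i ≤ℤ score q (after p x v s)

score+stone≤ {p = p} now₁ (x ∷ v) (px ∷ pv) s =
  ℤ.≤-trans (score+taken≤ p v s pv) (take₁-≤ p x v s)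
score+stone≤ {p = p} now₂ (x ∷ y ∷ v) (px ∷ py ∷ pv) s = begin
  -- The chosen stone is the last of those taken; the stone before it only adds to the gain.
  score p s +ℤ y                         ≤⟨ ℤ.+-monoʳ-≤ (score p s) (≤-nonNeg-+ y (1≤⇒0≤ px)) ⟩
  score p s +ℤ (x +ℤ y)                  ≤⟨ score+taken≤ p v s pv ⟩
  score p (after p (x +ℤ y) v s)         ≤⟨ take₂-≤ p x y v s ⟩
  score p (finalScores p (x ∷ y ∷ v) s)  ∎
  where open ℤ.≤-Reasoning
score+stone≤ {p = p} now₃ (x ∷ y ∷ z ∷ v) (px ∷ py ∷ pz ∷ pv) s = begin
  score p s +ℤ z                             ≤⟨ ℤ.+-monoʳ-≤ (score p s) (≤-nonNeg-+ z (ℤ.+-mono-≤ (1≤⇒0≤ px) (1≤⇒0≤ py))) ⟩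
  score p s +ℤ (x +ℤ y +ℤ z)                 ≤⟨ score+taken≤ p v s pv ⟩
  score p (after p (x +ℤ y +ℤ z) v s)        ≤⟨ take₃-≤ p x y z v s ⟩
  score p (finalScores p (x ∷ y ∷ z ∷ v) s)  ∎
  where open ℤ.≤-Reasoning
score+stone≤ {p = p} (later₁ h) (x ∷ v) (px ∷ pv) s =
  ℤ.≤-trans (score+stone≤after h v (1≤⇒0≤ px) pv s) (take₁-≤ p x v s)
score+stone≤ {p = p} (later₂ h) (x ∷ y ∷ v) (px ∷ py ∷ pv) s =
  ℤ.≤-trans (score+stone≤after h v (ℤ.+-mono-≤ (1≤⇒0≤ px) (1≤⇒0≤ py)) pv s) (take₂-≤ p x y v s)
score+stone≤ {p = p} (later₃ h) (x ∷ y ∷ z ∷ v) (px ∷ py ∷ pz ∷ pv) s =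
  ℤ.≤-trans
    (score+stone≤after h v (ℤ.+-mono-≤ (ℤ.+-mono-≤ (1≤⇒0≤ px) (1≤⇒0≤ py)) (1≤⇒0≤ pz)) pv s)
    (take₃-≤ p x y z v s)
score+stone≤ {p = p} {q} {i} (forced h₁ h₂ h₃) w@(x ∷ y ∷ z ∷ v) (px ∷ py ∷ pz ∷ pv) s =
  finalScores-elim₃ (λ s′ → score q s +ℤ lookup w i ≤ℤ score q s′) p v s
    (score+stone≤after h₁ (y ∷ z ∷ v) 0≤x (py ∷ pz ∷ pv) s)
    (score+stone≤after h₂ (z ∷ v) 0≤x+y (pz ∷ pv) s)
    (score+stone≤after h₃ v (ℤ.+-mono-≤ 0≤x+y (1≤⇒0≤ pz)) pv s)
  where
  0≤x   = 1≤⇒0≤ px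
  0≤x+y = ℤ.+-mono-≤ 0≤x (1≤⇒0≤ py)

score+stone≤after {p = p} {q} {x} {i} h v 0≤x pv s =
  ℤ.≤-trans (ℤ.+-monoˡ-≤ (lookup v i) (score≤credit q p s 0≤x))
    (score+stone≤ h v pv (credit p x s))

-- A dominant stone decides the game.

compareScores-winner : ∀ q s → score (opponent q) s <ℤ score q s → compareScores s ≡ winner q
compareScores-winner Alice ⟨ a , b ⟩ b<a with ℤ.<-cmp a b
... | tri< _ _ b≮a = contradiction b<a b≮a
... | tri≈ _ _ b≮a = contradiction b<a b≮a
... | tri> _ _ _   = refl
compareScores-winner Bob ⟨ a , b ⟩ a<b with ℤ.<-cmp a b
... | tri< _ _ _   = refl
... | tri≈ a≮b _ _ = contradiction a<b a≮b
... | tri> a≮b _ _ = contradiction a<b a≮b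

total-opponent : ∀ q s → score q s +ℤ score (opponent q) s ≡ total s
total-opponent Alice s = refl
total-opponent Bob   s = ℤ.+-comm (bob s) (alice s)

score-init : ∀ q → score q ⟨ 0ℤ , 0ℤ ⟩ ≡ 0ℤ
score-init Alice = refl
score-init Bob   = refl

-- `q` collects stone `i`. If the opponent scored at least as much as `q`, both scores would reach
-- the value of that stone, and the total of the row would be at least twice that value.
dominant-winner : ∀ {n} {q} {i : Fin n} {v : Vec ℤ n} → Positive v →
                  sum v <ℤ lookup v i +ℤ lookup v i → Takes Alice i q → outcome v ≡ winner q
dominant-winner {q = q} {i} {v} pv sum< h =
  compareScores-winner q s (ℤ.≰⇒> λ q≤ → ℤ.<⇒≱ sum< (begin
    lookup v i +ℤ lookup v i            ≤⟨ ℤ.+-mono-≤ stone≤ (ℤ.≤-trans stone≤ q≤) ⟩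
    score q s +ℤ score (opponent q) s   ≡⟨ total-opponent q s ⟩
    total s                             ≡⟨ total-finalScores Alice v _ ⟩
    0ℤ +ℤ sum v                         ≡⟨ ℤ.+-identityˡ _ ⟩
    sum v                               ∎))
  where
  open ℤ.≤-Reasoning
  s = finalScores Alice v ⟨ 0ℤ , 0ℤ ⟩
  stone≤ : lookup v i ≤ℤ score q s
  stone≤ = subst (_≤ℤ score q s)
    (trans (cong (_+ℤ lookup v i) (score-init q)) (ℤ.+-identityˡ (lookup v i)))
    (score+stone≤ h v pv ⟨ 0ℤ , 0ℤ ⟩)

-- Making one stone dominant.

update-positive : ∀ {n} {v : Vec ℤ n} i {x} → 1ℤ ≤ℤ x → Positive v → Positive (v [ i ]≔ x)
update-positive zero    px (_ ∷ pv)  = px ∷ pv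
update-positive (suc i) px (py ∷ pv) = py ∷ update-positive i px pv

-- Adding the old stone back on the left avoids subtraction.
sum-update : ∀ {n} (v : Vec ℤ n) i x → sum (v [ i ]≔ x) +ℤ lookup v i ≡ sum v +ℤ x
sum-update (y ∷ v) zero x = eq x y (sum v)
  where
  eq : ∀ x y r → x +ℤ r +ℤ y ≡ y +ℤ r +ℤ x
  eq = solve-∀
sum-update (y ∷ v) (suc i) x = begin
  y +ℤ sum (v [ i ]≔ x) +ℤ lookup v i    ≡⟨ ℤ.+-assoc y _ _ ⟩
  y +ℤ (sum (v [ i ]≔ x) +ℤ lookup v i)  ≡⟨ cong (y +ℤ_) (sum-update v i x) ⟩
  y +ℤ (sum v +ℤ x)                      ≡⟨ ℤ.+-assoc y _ _ ⟨
  y +ℤ sum v +ℤ x                        ∎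
  where open ≡-Reasoning

0≤sum : ∀ {n} {v : Vec ℤ n} → Positive v → 0ℤ ≤ℤ sum v
0≤sum []        = ℤ.≤-refl
0≤sum (px ∷ pv) = ℤ.+-mono-≤ (1≤⇒0≤ px) (0≤sum pv)

1≤sum : ∀ {n} {v : Vec ℤ (suc n)} → Positive v → 1ℤ ≤ℤ sum v
1≤sum (px ∷ pv) = ℤ.+-mono-≤ px (0≤sum pv)

-- The old total is large enough: in a positive row the other stones together are worth less, as
-- stone `i` contributed at least 1. Values are unbounded, so this can be done to a row that already
-- has a dominant stone.
dominate : ∀ {n} → Fin n → Vec ℤ n → Vec ℤ n
dominate i v = v [ i ]≔ sum v

dominate-positive : ∀ {n} (i : Fin n) {v} → Positive v → Positive (dominate i v)
dominate-positive {suc _} i pv = update-positive i (1≤sum pv) pv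

dominate-winner : ∀ {n} {q} {i : Fin n} {v} → Positive v → Takes Alice i q →
                  outcome (dominate i v) ≡ winner q
dominate-winner {i = i} {v} pv = dominant-winner (dominate-positive i pv) (begin-strict
  -- The inequality is strict because the replaced stone was worth at least 1.
  sum (dominate i v)                                       <⟨ below (All.lookup⁺ pv i) ⟩
  sum (dominate i v) +ℤ lookup v i                         ≡⟨ sum-update v i (sum v) ⟩
  sum v +ℤ sum v                                           ≡⟨ cong₂ _+ℤ_ stone stone ⟨
  lookup (dominate i v) i +ℤ lookup (dominate i v) i       ∎)
  where
  open ℤ.≤-Reasoning
  stone : lookup (dominate i v) i ≡ sum v
  stone = lookup∘update i v (sum v)
  below : ∀ {a x} → 1ℤ ≤ℤ x → a <ℤ a +ℤ x
  below {a} {x} 1≤x = subst (λ b → b <ℤ a +ℤ x) (ℤ.+-identityʳ a) (ℤ.+-monoʳ-< a (ℤ.suc[i]≤j⇒i<j 1≤x))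

winner⇒admissible : ∀ {n} {v : Vec ℤ n} {q} → Positive v → outcome v ≡ winner q → Admissible v
winner⇒admissible pv wins = pv , λ tied → contradiction (trans (sym wins) tied) λ ()

dominate-admissible : ∀ {n} {q} {i : Fin n} {v} → Positive v → Takes Alice i q →
                      Admissible (dominate i v)
dominate-admissible {i = i} pv h = winner⇒admissible (dominate-positive i pv) (dominate-winner pv h)

replicate-positive : ∀ n → Positive (replicate n 1ℤ)
replicate-positive zero    = []
replicate-positive (suc n) = ℤ.≤-refl ∷ replicate-positive n

-- Stones with index 3 mod 4.

-- `combine k 3F` is the index 4k + 3.
fourth : ∀ {n} → Fin (n / 4) → Fin n
fourth {n} k = inject≤ (combine {n = 4} k 3F) (m/n*n≤m n 4)

fourth-injective : ∀ {n} {k l : Fin (n / 4)} → fourth {n} k ≡ fourth l → k ≡ l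
fourth-injective {k = k} {l} eq =
  combine-injectiveˡ k 3F l 3F (inject≤-injective _ _ (combine k 3F) (combine l 3F) eq)

-- Bob answers a move of 1, 2 or 3 stones with 3, 2 or 1, so each round removes four stones and
-- Alice again faces an index 3 mod 4. At index 3 she cannot reach the stone, and any move of hers
-- brings it within Bob's reach.
takes-3mod4 : ∀ {m n} (k : Fin m) (le : m * 4 ≤ n) → Takes Alice (inject≤ (combine {n = 4} k 3F) le) Bob
-- Matching on the inequality exposes four stones of the row, which lets `inject≤` compute.
takes-3mod4 zero    (s≤s (s≤s (s≤s (s≤s le)))) = forced now₃ now₂ now₁
takes-3mod4 (suc k) (s≤s (s≤s (s≤s (s≤s le)))) = forced (later₃ h) (later₂ h) (later₁ h)
  where h = takes-3mod4 k le

-- The adversary argument for algorithms.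

module _ (A : Algorithm) where
  open Algorithm A

  inspected : ∀ {n} {v : Vec ℤ n} {σ w t} → HaltsFrom A v σ w t → List (Fin n)
  inspected (halt _)           = []
  inspected (work _ h)         = inspected h
  inspected (look {i = i} _ h) = i ∷ inspected h

  length-inspected : ∀ {n} {v : Vec ℤ n} {σ w t} (h : HaltsFrom A v σ w t) → length (inspected h) ≤ t
  length-inspected (halt _)   = z≤n
  length-inspected (work _ h) = ℕ.m≤n⇒m≤1+n (length-inspected h)
  length-inspected (look _ h) = s≤s (length-inspected h)

  -- The input enters a run only through the answers to inspections, so the same run is valid on any
  -- row giving the same answers.
  halts-agree : ∀ {n} {v v′ : Vec ℤ n} {σ w t} (h : HaltsFrom A v σ w t) →
                (∀ {i} → i ∈ inspected h → lookup v i ≡ lookup v′ i) → HaltsFrom A v′ σ w t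
  halts-agree (halt e)           agree = halt e
  halts-agree (work e h)         agree = work e (halts-agree h agree)
  halts-agree {v′ = v′} (look {k = k} {w} {t} e h) agree =
    look e (subst (λ x → HaltsFrom A v′ (k x) w t) (agree (here refl))
      (halts-agree h λ i∈ → agree (there i∈)))

  output-unique : ∀ {n} {v : Vec ℤ n} {σ w w′ t t′} →
                  HaltsFrom A v σ w t → HaltsFrom A v σ w′ t′ → w ≡ w′
  output-unique (halt e)   (halt e′)    with refl ← trans (sym e) e′ = refl
  output-unique (halt e)   (work e′ _)  with () ← trans (sym e) e′
  output-unique (halt e)   (look e′ _)  with () ← trans (sym e) e′
  output-unique (work e _) (halt e′)    with () ← trans (sym e) e′
  output-unique (work e h) (work e′ h′) with refl ← trans (sym e) e′ = output-unique h h′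
  output-unique (work e _) (look e′ _)  with () ← trans (sym e) e′
  output-unique (look e _) (halt e′)    with () ← trans (sym e) e′
  output-unique (look e _) (work e′ _)  with () ← trans (sym e) e′
  output-unique (look e h) (look e′ h′) with refl ← trans (sym e) e′ = output-unique h h′

  module _ (correct : Correct A) where

    -- Correctness supplies some halting run with the right output; determinism carries this over to
    -- the run at hand.
    output-correct : ∀ {n} {v : Vec ℤ n} {w t} → Admissible v → Halts A v w t → outcome v ≡ winner w
    output-correct {n} {v} adm h with _ , _ , h′ , eq ← correct n v adm =
      trans eq (cong winner (output-unique h′ h))

    -- If stone `i` were never inspected, the same run would give the same answer on the changed
    -- row; being right on both rows, it would force equal outcomes.
    sensitive⇒inspected : ∀ {n} {v : Vec ℤ n} {i x w t} → Admissible v → Admissible (v [ i ]≔ x) →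
                          outcome v ≢ outcome (v [ i ]≔ x) →
                          (h : Halts A v w t) → i ∈ inspected h
    sensitive⇒inspected {v = v} {i} {x} adm adm′ differ h =
      decidable-stable (_∈?_ _≟_ i (inspected h)) λ i∉ →
        differ (trans (output-correct adm h) (sym (output-correct adm′ (halts-agree h λ j∈ →
          sym (lookup∘update′ (λ { refl → i∉ j∈ }) v x)))))

    -- Each of the `n / 4` stones with index 3 mod 4 could hand the win to Bob, so all of them occur
    -- in the list of inspections of this one run.
    n/4≤time : ∀ {n} {v : Vec ℤ n} {w t} → Positive v → outcome v ≡ winner Alice →
               Halts A v w t → n / 4 ≤ t
    n/4≤time {n} {v} pv alice-wins h =
      ℕ.≤-trans (injective⇒≤ position-injective) (length-inspected h)
      where
      bob-takes : ∀ k → Takes Alice (fourth k) Bob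
      bob-takes k = takes-3mod4 k (m/n*n≤m n 4)

      differ : ∀ k → outcome v ≢ outcome (dominate (fourth k) v)
      differ k eq with () ← trans (sym alice-wins) (trans eq (dominate-winner pv (bob-takes k)))

      seen : ∀ k → fourth k ∈ inspected h
      seen k = sensitive⇒inspected (winner⇒admissible pv alice-wins)
        (dominate-admissible pv (bob-takes k)) (differ k) h

      -- One place in the list holds one stone, so distinct stones occupy distinct places and the
      -- list has length at least `n / 4`.
      position-injective : ∀ {k l} → index (seen k) ≡ index (seen l) → k ≡ l
      position-injective {k} {l} eq =
        fourth-injective (Membership.index-injective (setoid (Fin n)) (seen k) (seen l) eq)

-- The linear bound.

n≤7t : ∀ n {t} → 4 ≤ n → n / 4 ≤ t → n ≤ 7 * t
n≤7t n {t} 4≤n q≤t = begin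
  n                       ≡⟨ m≡m%n+[m/n]*n n 4 ⟩
  n % 4 + n / 4 * 4       ≤⟨ ℕ.+-mono-≤ (ℕ.≤-pred (m%n<n n 4)) (ℕ.*-monoˡ-≤ 4 q≤t) ⟩
  -- Since `n` is at least 4, `n / 4` and hence `t` is at least 1, so the remainder 3 is absorbed
  -- into `3 * t`.
  3 * 1 + t * 4           ≤⟨ ℕ.+-monoˡ-≤ (t * 4) (ℕ.*-monoʳ-≤ 3 (ℕ.≤-trans (m≥n⇒m/n>0 4≤n) q≤t)) ⟩
  3 * t + t * 4           ≡⟨ cong (3 * t +_) (ℕ.*-comm t 4) ⟩
  3 * t + 4 * t           ≡⟨ ℕ.*-distribʳ-+ t 3 4 ⟨
  7 * t                   ∎
  where open ℕ.≤-Reasoning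

theorem7p2 : (A : Algorithm) → Correct A → WorstCaseΩ id (RunningTime A)
theorem7p2 A correct = 7 , 4 , bound
  where
  bound : ∀ n → 4 ≤ n → ∃[ t ] RunningTime A n t × n ≤ 7 * t
  bound n@(suc _) 4≤n =
    let ones = replicate-positive n
        -- The hard row is all ones with stone 0 raised to `n`; Alice takes that stone on her first
        -- move and wins.
        admissible = dominate-admissible {i = zero} ones now₁
        w , t , h , _ = correct n (dominate zero (replicate n 1ℤ)) admissible
    in t , (_ , admissible , w , h) ,
       n≤7t n 4≤n (n/4≤time A correct (proj₁ admissible) (dominate-winner {i = zero} ones now₁) h)
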